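{- Let $n \geq 4$ and let $\mathbb{G}$ be a reflexive $n$-cycle. Then $\mathbb{G}$ is Słupecki, i.e. for every $k \geq 1$, every surjective homomorphism $f:\mathbb{G}^k \rightarrow \mathbb{G}$ is essentially unary.
   Context: A digraph $\mathbb{G}=\langle G;E\rangle$ is a non-empty vertex set $G$ with a binary relation $E$ on $G$ (the arcs); it is reflexive if $(x,x)\in E$ for all $x \in G$. All digraphs are reflexive. A homomorphism is an arc-preserving map. The product of digraphs is the usual product of relational structures (arcs are coordinatewise), and $\mathbb{G}^k$ is the $k$-th power. A $k$-ary polymorphism of $\mathbb{G}$ is a homomorphism $\mathbb{G}^k\to\mathbb{G}$; it is essentially unary if there exist $1\le i\le k$ and a homomorphism $g:\mathbb{G}\to\mathbb{G}$ with $f(x_1,\dots,x_k)=g(x_i)$ for all $x_1,\dots,x_k\in G$. $\mathbb{G}$ is Słupecki if all its surjective polymorphisms are essentially unary. For $n\ge 3$, an $n$-cycle is a reflexive digraph with vertex set $\{0,\dots,n-1\}$ such that for each $i$ (indices modulo $n$) at least one of the arcs $(i,i+1)$, $(i+1,i)$ is present (possibly both), and there are no other arcs besides loops. -}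

module Defs where

open import Level using (Level; 0ℓ; _⊔_) renaming (suc to lsuc)
open import Data.Nat using (ℕ; suc; _≥_; s≤s)
open import Data.Nat.DivMod using (_mod_)
open import Data.Fin using (Fin; zero; toℕ)
open import Data.Product using (∃-syntax; _×_)
open import Data.Sum using (_⊎_)
open import Data.Vec using (Vec; lookup; replicate)
open import Data.Vec.Relation.Binary.Pointwise.Inductive as Pointwise using (Pointwise)
open import Function.Definitions using (Surjective)
open import Relation.Binary.Core using (Rel; _Preserves_⟶_)
open import Relation.Binary.Definitions using (Reflexive)
open import Relation.Binary.PropositionalEquality using (_≡_)

-- All digraphs are reflexive; arcs are not assumed decidable.
record Digraph (v e : Level) : Set (lsuc (v ⊔ e)) where
  field
    Vertex    : Set v
    Arc       : Rel Vertex e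
    nonEmpty  : Vertex
    reflexive : Reflexive Arc

open Digraph public

private
  variable
    v e v′ e′ : Level

IsHomomorphism : (𝔾 : Digraph v e) (ℍ : Digraph v′ e′) →
                 (Vertex 𝔾 → Vertex ℍ) → Set _
IsHomomorphism 𝔾 ℍ f = f Preserves Arc 𝔾 ⟶ Arc ℍ

power : Digraph v e → ℕ → Digraph v (v ⊔ e)
power 𝔾 k = record
  { Vertex    = Vec (Vertex 𝔾) k
  ; Arc       = Pointwise (Arc 𝔾)
  ; nonEmpty  = replicate k (nonEmpty 𝔾)
  ; reflexive = Pointwise.refl (reflexive 𝔾)
  }

IsPolymorphism : (𝔾 : Digraph v e) (k : ℕ) → (Vec (Vertex 𝔾) k → Vertex 𝔾) → Set _
IsPolymorphism 𝔾 k = IsHomomorphism (power 𝔾 k) 𝔾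

EssentiallyUnary : (𝔾 : Digraph v e) (k : ℕ) → (Vec (Vertex 𝔾) k → Vertex 𝔾) → Set _
EssentiallyUnary 𝔾 k f =
  ∃[ i ] ∃[ g ] IsHomomorphism 𝔾 𝔾 g × (∀ (xs : Vec (Vertex 𝔾) k) → f xs ≡ g (lookup xs i))

Słupecki : Digraph v e → Set _
Słupecki 𝔾 = ∀ (k : ℕ) → k ≥ 1 → (f : Vec (Vertex 𝔾) k → Vertex 𝔾) →
  IsPolymorphism 𝔾 k f → Surjective _≡_ _≡_ f → EssentiallyUnary 𝔾 k f

-- i ↦ i + 1 modulo n
next : ∀ {n} → Fin n → Fin n
next {suc n} i = suc (toℕ i) mod suc n

record Cycle (n : ℕ) (e : Level) : Set (lsuc e) where
  field
    n≥3         : n ≥ 3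
    _⟶_         : Rel (Fin n) e
    loops       : Reflexive _⟶_
    consecutive : ∀ i → (i ⟶ next i) ⊎ (next i ⟶ i)
    noOthers    : ∀ {i j} → i ⟶ j → i ≡ j ⊎ j ≡ next i ⊎ i ≡ next j

  digraph : Digraph 0ℓ e
  digraph = record
    { Vertex    = Fin n
    ; Arc       = _⟶_
    ; nonEmpty  = vertex n≥3
    ; reflexive = loops
    }
    where
    vertex : ∀ {m} → m ≥ 3 → Fin m
    vertex (s≤s _) = zero

module Submission where

-- Compare a polymorphism f : 𝔾ᵏ → 𝔾 with the universal cover π : ℤ → ℤ/n.  Since n ≥ 4, every triangle
-- of arcs lifts, and every square of a product has a diagonal; hence either f lifts to F : 𝔾ᵏ → ℤ, or f
-- winds around the cycle along some line parallel to an axis.  In the second case the restriction to that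
-- line is a ↦ c ± a.  Such a map has no neighbour but itself among the endomorphisms of 𝔾, and 𝔾ᵏ is
-- connected, so f depends on a single coordinate.  In the first case f is not surjective, because F takes
-- values in a window of n - 1 consecutive integers: for each height A there is a word of arc directions
-- that joins any two vertices of 𝔾 (hence, coordinatewise, any two vertices of 𝔾ᵏ), but along which a
-- walk in the cover starting at A cannot climb higher than A + n - 2.

open import Level using (Level)
open import Data.Bool using (Bool; true; false; not)
open import Data.Bool.Properties using (not-involutive)
open import Data.Empty using (⊥; ⊥-elim)
open import Data.Fin using (Fin; zero; suc; toℕ; fromℕ<)
import Data.Fin.Properties as Fin
open import Data.Integer as ℤ using (ℤ; +_; -[1+_]; -_; _+_; _-_; _*_; ∣_∣; 0ℤ; 1ℤ; -1ℤ)
import Data.Integer.DivMod as ℤ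
import Data.Integer.Properties as ℤ
open import Data.Integer.Tactic.RingSolver using (solve-∀)
open import Data.List using (List; []; _∷_; _++_)
open import Data.Nat as ℕ using (ℕ; zero; suc; z≤n; s≤s; _≥_)
import Data.Nat.DivMod as ℕ
import Data.Nat.Properties as ℕ
import Data.Nat.Tactic.RingSolver as ℕ-solver
open import Data.Product using (∃-syntax; Σ-syntax; _×_; _,_; proj₁; proj₂)
open import Data.Sum as Sum using (_⊎_; inj₁; inj₂; swap)
open import Data.Vec using (Vec; []; _∷_; lookup; replicate; _[_]≔_)
open import Data.Vec.Properties using (lookup-replicate; lookup∘update; []≔-lookup)
open import Data.Vec.Relation.Binary.Pointwise.Inductive as Pointwise using (Pointwise; []; _∷_)
open import Effect.Monad using (RawMonad)
open import Function using (_∘_; flip)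
open import Function.Definitions using (Surjective)
open import Relation.Binary using (Rel; Reflexive)
import Relation.Binary.Construct.Closure.ReflexiveTransitive as Star
open Star using (_◅_; _◅◅_)
open import Relation.Binary.Construct.Closure.Symmetric using (SymClosure; fwd; bwd)
open import Relation.Binary.Construct.Closure.Equivalence as EqClosure using (EqClosure)
open import Relation.Binary.PropositionalEquality
open import Relation.Nullary using (¬_; Dec; yes; no)
open import Relation.Nullary.Decidable using (¬¬-excluded-middle; toSum)
open import Relation.Nullary.Negation using (¬¬-Monad)
open import Defs

-- Distances and signs in the integers.

dist : ℤ → ℤ → ℕ
dist a b = ∣ a - b ∣

dist-refl : ∀ a → dist a a ≡ 0
dist-refl a = cong ∣_∣ (ℤ.+-inverseʳ a)

dist-sym : ∀ a b → dist a b ≡ dist b a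
dist-sym = ℤ.∣i-j∣≡∣j-i∣

dist-triangle : ∀ a b c {d e} → dist a b ℕ.≤ d → dist b c ℕ.≤ e → dist a c ℕ.≤ d ℕ.+ e
dist-triangle a b c {d} {e} p q = begin
  ∣ a - c ∣                  ≡⟨ cong ∣_∣ (split a b c) ⟩
  ∣ (a - b) + (b - c) ∣      ≤⟨ ℤ.∣i+j∣≤∣i∣+∣j∣ (a - b) (b - c) ⟩
  dist a b ℕ.+ dist b c      ≤⟨ ℕ.+-mono-≤ p q ⟩
  d ℕ.+ e                    ∎
  where
  open ℕ.≤-Reasoning
  split : ∀ a b c → a - c ≡ (a - b) + (b - c)
  split = solve-∀

dist-flip : ∀ a b {d} → dist a b ℕ.≤ d → dist b a ℕ.≤ d
dist-flip a b = subst (ℕ._≤ _) (dist-sym a b)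

dist-shift : ∀ a b → dist a (a + b) ≡ ∣ b ∣
dist-shift a b = trans (dist-sym a (a + b)) (cong ∣_∣ (lemma a b))
  where
  lemma : ∀ a b → a + b - a ≡ b
  lemma = solve-∀

≤-of-dist : ∀ a b {m} → dist a b ℕ.≤ m → b ℤ.≤ a + + m
≤-of-dist a b {m} d = subst (ℤ._≤ a + + m) (undo a b)
  (ℤ.+-monoʳ-≤ a (ℤ.≤-trans (i≤∣i∣ (b - a)) (ℤ.+≤+ (dist-flip a b d))))
  where
  undo : ∀ a b → a + (b - a) ≡ b
  undo = solve-∀
  i≤∣i∣ : ∀ i → i ℤ.≤ + ∣ i ∣
  i≤∣i∣ (+ _)    = ℤ.≤-refl
  i≤∣i∣ -[1+ _ ] = ℤ.-≤+

dist-of-≤ : ∀ a b {m} → a ℤ.≤ b + + m → b ℤ.≤ a + + m → dist a b ℕ.≤ m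
dist-of-≤ a b {m} p r = bound (a - b) (difference a b p) (subst (ℤ._≤ + m) (negate b a) (difference b a r))
  where
  cancel : ∀ b m → b + m - b ≡ m
  cancel = solve-∀
  negate : ∀ b a → b - a ≡ - (a - b)
  negate = solve-∀
  difference : ∀ a b → a ℤ.≤ b + + m → a - b ℤ.≤ + m
  difference a b p = subst (a - b ℤ.≤_) (cancel b (+ m)) (ℤ.+-monoˡ-≤ (- b) p)
  bound : ∀ i → i ℤ.≤ + m → - i ℤ.≤ + m → ∣ i ∣ ℕ.≤ m
  bound (+ _)    p _ = ℤ.drop‿+≤+ p
  bound -[1+ _ ] _ r = ℤ.drop‿+≤+ r

Unit : ℤ → Set
Unit ε = ε ≡ 1ℤ ⊎ ε ≡ -1ℤ

Unit-neg : ∀ {ε} → Unit ε → Unit (- ε)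
Unit-neg (inj₁ refl) = inj₂ refl
Unit-neg (inj₂ refl) = inj₁ refl

Unit-* : ∀ {ε η} → Unit ε → Unit η → Unit (ε * η)
Unit-* (inj₁ refl) (inj₁ refl) = inj₁ refl
Unit-* (inj₁ refl) (inj₂ refl) = inj₂ refl
Unit-* (inj₂ refl) (inj₁ refl) = inj₂ refl
Unit-* (inj₂ refl) (inj₂ refl) = inj₁ refl

Unit-square : ∀ {ε} → Unit ε → ε * ε ≡ 1ℤ
Unit-square (inj₁ refl) = refl
Unit-square (inj₂ refl) = refl

∣Unit∣ : ∀ {ε} → Unit ε → ∣ ε ∣ ≡ 1
∣Unit∣ (inj₁ refl) = refl
∣Unit∣ (inj₂ refl) = refl

∣i∣≤1 : ∀ i → ∣ i ∣ ℕ.≤ 1 → i ≡ 0ℤ ⊎ Unit i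
∣i∣≤1 (+ 0)        _ = inj₁ refl
∣i∣≤1 (+ 1)        _ = inj₂ (inj₁ refl)
∣i∣≤1 (+ suc (suc _)) (s≤s ())
∣i∣≤1 -[1+ 0 ]     _ = inj₂ (inj₂ refl)
∣i∣≤1 -[1+ suc _ ] (s≤s ())

-- 0 and ε (m + k) are exactly m + k apart, so both bounds on x are sharp.
taut : ∀ {ε} x m k → Unit ε → ∣ x ∣ ℕ.≤ m → dist (ε * + (m ℕ.+ k)) x ℕ.≤ k → x ≡ ε * + m
taut x m k (inj₁ refl) p q =
  trans (positive x p (subst (λ y → dist y x ℕ.≤ k) (ℤ.*-identityˡ (+ (m ℕ.+ k))) q))
        (sym (ℤ.*-identityˡ (+ m)))
  where
  positive : ∀ x → ∣ x ∣ ℕ.≤ m → dist (+ (m ℕ.+ k)) x ℕ.≤ k → x ≡ + m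
  positive (+ j) j≤m d≤k = cong +_ (ℕ.≤-antisym j≤m (ℕ.+-cancelʳ-≤ k m j
    (ℕ.≤-trans (ℕ.m≤n+m∸n (m ℕ.+ k) j) (ℕ.+-monoʳ-≤ j (subst (ℕ._≤ k) distance d≤k)))))
    where
    distance : dist (+ (m ℕ.+ k)) (+ j) ≡ m ℕ.+ k ℕ.∸ j
    distance = trans (dist-sym (+ (m ℕ.+ k)) (+ j))
      (trans (cong ∣_∣ (ℤ.m-n≡m⊖n j (m ℕ.+ k))) (ℤ.∣⊖∣-≤ (ℕ.≤-trans j≤m (ℕ.m≤m+n m k))))
  positive -[1+ j ] _ d≤k =
    ⊥-elim (ℕ.<-irrefl refl (ℕ.<-≤-trans (ℕ.m<n+m k (s≤s z≤n))
      (ℕ.≤-trans (ℕ.≤-trans (ℕ.m≤n+m (suc j ℕ.+ k) m) (ℕ.≤-reflexive (rearrange m (suc j) k))) d≤k)))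
    where
    rearrange : ∀ m j k → m ℕ.+ (j ℕ.+ k) ≡ m ℕ.+ k ℕ.+ j
    rearrange m j k = trans (cong (m ℕ.+_) (ℕ.+-comm j k)) (sym (ℕ.+-assoc m k j))
taut x m k (inj₂ refl) p q =
  trans (sym (ℤ.neg-involutive x)) (trans (cong -_ negated) (lemma (+ m)))
  where
  lemma : ∀ y → - (1ℤ * y) ≡ -1ℤ * y
  lemma = solve-∀
  reflect : ∀ y x → - (-1ℤ * y - x) ≡ 1ℤ * y - - x
  reflect = solve-∀
  negated : - x ≡ 1ℤ * + m
  negated = taut (- x) m k (inj₁ refl) (subst (ℕ._≤ m) (sym (ℤ.∣-i∣≡∣i∣ x)) p)
    (subst (ℕ._≤ k) (trans (sym (ℤ.∣-i∣≡∣i∣ (-1ℤ * + (m ℕ.+ k) - x))) (cong ∣_∣ (reflect (+ (m ℕ.+ k)) x))) q)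

between : ∀ {η} x → Unit η → ∣ x + η ∣ ℕ.≤ 1 → ∣ x - η ∣ ℕ.≤ 1 → x ≡ 0ℤ
between (+ 0) _ _ _ = refl
between (+ suc m) (inj₁ refl) p _
  with s≤s () ← ℕ.≤-trans (ℕ.≤-reflexive (cong suc (ℕ.+-comm 1 m))) p
between (+ suc m) (inj₂ refl) _ p
  with s≤s () ← ℕ.≤-trans (ℕ.≤-reflexive (cong suc (ℕ.+-comm 1 m))) p
between -[1+ m ] (inj₁ refl) _ (s≤s ())
between -[1+ m ] (inj₂ refl) (s≤s ()) _

-- The residue map `π` from ℤ onto ℤ/n.

module Residues (p : ℕ) where

  n : ℕ
  n = suc p

  opaque
    π : ℤ → Fin n
    π a = fromℕ< (ℤ.n%ℕd<d a n)

    quotient : ∀ a → ∃[ q ] a ≡ + toℕ (π a) + q * + n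
    quotient a = a ℤ./ℕ n , subst (λ r → a ≡ + r + (a ℤ./ℕ n) * + n) (sym (Fin.toℕ-fromℕ< (ℤ.n%ℕd<d a n)))
                       (ℤ.a≡a%ℕn+[a/ℕn]*n a n)

  multiple-small : ∀ q → ∣ q * + n ∣ ℕ.< n → q ≡ 0ℤ
  multiple-small q small = ℤ.∣i∣≡0⇒i≡0 (go ∣ q ∣ (subst (ℕ._< n) (ℤ.∣i*j∣≡∣i∣*∣j∣ q (+ n)) small))
    where
    go : ∀ m → m ℕ.* n ℕ.< n → m ≡ 0
    go zero    _ = refl
    go (suc m) l = ⊥-elim (ℕ.<-irrefl refl (ℕ.≤-<-trans (ℕ.m≤m+n n (m ℕ.* n)) l))

  dist-multiple : ∀ a b q → a ≡ b + q * + n → dist a b ℕ.< n → a ≡ b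
  dist-multiple a b q eq l = trans eq (trans (cong (λ q → b + q * + n) q≡0) (ℤ.+-identityʳ b))
    where
    lemma : ∀ b m → b + m - b ≡ m
    lemma = solve-∀
    q≡0 : q ≡ 0ℤ
    q≡0 = multiple-small q (subst (λ d → ∣ d ∣ ℕ.< n) (trans (cong (_- b) eq) (lemma b (q * + n))) l)

  dist-Fin : ∀ (u v : Fin n) → dist (+ toℕ u) (+ toℕ v) ℕ.< n
  dist-Fin u v = subst (ℕ._< n) (cong ∣_∣ (sym (ℤ.m-n≡m⊖n (toℕ u) (toℕ v))))
    (ℕ.≤-<-trans (ℤ.∣m⊝n∣≤m⊔n (toℕ u) (toℕ v)) (ℕ.⊔-lub (Fin.toℕ<n u) (Fin.toℕ<n v)))

  π-unique : ∀ a u q → a ≡ + toℕ u + q * + n → π a ≡ u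
  π-unique a u q eq with quotient a
  ... | q′ , eq′ = Fin.toℕ-injective (ℤ.+-injective
    (dist-multiple (+ toℕ (π a)) (+ toℕ u) (q - q′)
      (solved (+ toℕ (π a)) (+ toℕ u) q q′ (+ n) (trans (sym eq′) eq)) (dist-Fin (π a) u)))
    where
    add-sub : ∀ x y → x ≡ x + y - y
    add-sub = solve-∀
    regroup : ∀ u q q′ n → u + q * n - q′ * n ≡ u + (q - q′) * n
    regroup = solve-∀
    solved : ∀ r u q q′ n → r + q′ * n ≡ u + q * n → r ≡ u + (q - q′) * n
    solved r u q q′ n e = trans (add-sub r (q′ * n)) (trans (cong (_- q′ * n) e) (regroup u q q′ n))

  π-cong : ∀ a b q → a ≡ b + q * + n → π a ≡ π b
  π-cong a b q eq with quotient b
  ... | q′ , eq′ = π-unique a (π b) (q′ + q)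
    (trans eq (trans (cong (_+ q * + n) eq′) (regroup (+ toℕ (π b)) q′ q (+ n))))
    where
    regroup : ∀ u q q′ n → u + q * n + q′ * n ≡ u + (q + q′) * n
    regroup = solve-∀

  π-injective-mod : ∀ a b → π a ≡ π b → ∃[ q ] a ≡ b + q * + n
  π-injective-mod a b eq with quotient a | quotient b
  ... | q , e | q′ , e′ = (q - q′) ,
    trans e (trans (cong (λ u → + toℕ u + q * + n) eq)
      (trans (regroup (+ toℕ (π b)) q q′ (+ n)) (cong (_+ (q - q′) * + n) (sym e′))))
    where
    regroup : ∀ u q q′ n → u + q * n ≡ u + q′ * n + (q - q′) * n
    regroup = solve-∀

  -- Distinct points of a fibre of `π` are at least n apart. So a rough location determines a
  -- preimage, which is how `tighten` and `one-lower` identify values in the cover.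
  π-injective : ∀ a b → π a ≡ π b → dist a b ℕ.< n → a ≡ b
  π-injective a b eq with π-injective-mod a b eq
  ... | q , e = dist-multiple a b q e

  π-toℕ : ∀ u → π (+ toℕ u) ≡ u
  π-toℕ u = π-unique (+ toℕ u) u 0ℤ (sym (ℤ.+-identityʳ _))

  π-next : ∀ a → next (π a) ≡ π (a + 1ℤ)
  π-next a with quotient a
  ... | q , e = sym (π-unique (a + 1ℤ) (next (π a)) (+ k + q) (begin
      a + 1ℤ                                    ≡⟨ cong (_+ 1ℤ) e ⟩
      + r + q * + n + 1ℤ                        ≡⟨ regroup (+ r) q (+ n) ⟩
      + suc r + q * + n                         ≡⟨ cong (λ m → + m + q * + n) (ℕ.m≡m%n+[m/n]*n (suc r) n) ⟩
      + (suc r ℕ.% n ℕ.+ k ℕ.* n) + q * + n     ≡⟨ cong (λ m → + (m ℕ.+ k ℕ.* n) + q * + n) (sym (Fin.toℕ-fromℕ< (ℕ.m%n<n (suc r) n))) ⟩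
      + (r′ ℕ.+ k ℕ.* n) + q * + n              ≡⟨ cong (_+ q * + n) (trans (ℤ.pos-+ r′ (k ℕ.* n)) (cong (_+_ (+ r′)) (ℤ.pos-* k n))) ⟩
      + r′ + + k * + n + q * + n                ≡⟨ regroup′ (+ r′) (+ k) q (+ n) ⟩
      + r′ + (+ k + q) * + n                    ∎))
    where
    open ≡-Reasoning
    r = toℕ (π a)
    r′ = toℕ (next (π a))
    k = suc r ℕ./ n
    regroup : ∀ r q n → r + q * n + 1ℤ ≡ 1ℤ + r + q * n
    regroup = solve-∀
    regroup′ : ∀ u k q n → u + k * n + q * n ≡ u + (k + q) * n
    regroup′ = solve-∀

  π-surjective-above : ∀ a u → ∃[ m ] m ℕ.< n × u ≡ π (a + + m)
  π-surjective-above a u with quotient (+ toℕ u - a)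
  ... | q , e = toℕ (π (+ toℕ u - a)) , Fin.toℕ<n (π (+ toℕ u - a)) ,
    trans (sym (π-toℕ u)) (π-cong (+ toℕ u) (a + + toℕ (π (+ toℕ u - a))) q
      (solved (+ toℕ u) a (+ toℕ (π (+ toℕ u - a))) (q * + n) e))
    where
    undo : ∀ u a → u ≡ a + (u - a)
    undo = solve-∀
    solved : ∀ u a r m → u - a ≡ r + m → u ≡ a + r + m
    solved u a r m e = trans (undo u a) (trans (cong (_+_ a) e) (sym (ℤ.+-assoc a r m)))

  next-induction : ∀ {ℓ} (P : Fin n → Set ℓ) → P zero → (∀ u → P u → P (next u)) → ∀ u → P u
  next-induction P base step u = subst P (π-toℕ u) (go (toℕ u))
    where
    go : ∀ m → P (π (+ m))
    go zero    = subst P (sym (π-toℕ zero)) base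
    go (suc m) = subst P (trans (π-next (+ m)) (cong π (ℤ.+-comm (+ m) 1ℤ))) (step _ (go m))

-- Loops in the cycle and their lifts to the cover.

opposite : ∀ {n e} → Cycle n e → Cycle n e
opposite 𝔾 = record
  { n≥3         = n≥3
  ; _⟶_         = flip _⟶_
  ; loops       = loops
  ; consecutive = swap ∘ consecutive
  ; noOthers    = λ a → reorder (noOthers a)
  }
  where
  open Cycle 𝔾
  reorder : ∀ {i j} → i ≡ j ⊎ j ≡ next i ⊎ i ≡ next j → j ≡ i ⊎ i ≡ next j ⊎ j ≡ next i
  reorder (inj₁ e) = inj₁ (sym e)
  reorder (inj₂ e) = inj₂ (swap e)

module Lifting (p : ℕ) (3≤p : 3 ℕ.≤ p) where
  open Residues p public

  Adjacent : Fin n → Fin n → Set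
  Adjacent u v = u ≡ v ⊎ v ≡ next u ⊎ u ≡ next v

  Adjacent-sym : ∀ {u v} → Adjacent u v → Adjacent v u
  Adjacent-sym (inj₁ e) = inj₁ (sym e)
  Adjacent-sym (inj₂ e) = inj₂ (swap e)

  private
    add-sub : ∀ a → a ≡ a - 1ℤ + 1ℤ
    add-sub = solve-∀

    dist-suc : ∀ a → dist a (a + 1ℤ) ℕ.≤ 1
    dist-suc a = ℕ.≤-reflexive (dist-shift a 1ℤ)

    dist-pred : ∀ a → dist a (a - 1ℤ) ℕ.≤ 1
    dist-pred a = ℕ.≤-reflexive (dist-shift a -1ℤ)

  π-next-injective : ∀ a v → π a ≡ next v → π (a - 1ℤ) ≡ v
  π-next-injective a v e =
    π-unique (a - 1ℤ) v (proj₁ period) (trans (cong (_- 1ℤ) (proj₂ period)) (regroup (+ toℕ v) (proj₁ period * + n)))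
    where
    period : ∃[ q ] a ≡ + toℕ v + 1ℤ + q * + n
    period = π-injective-mod a (+ toℕ v + 1ℤ) (trans e (trans (cong next (sym (π-toℕ v))) (π-next (+ toℕ v))))
    regroup : ∀ v m → v + 1ℤ + m - 1ℤ ≡ v + m
    regroup = solve-∀

  follow : ∀ a v → Adjacent (π a) v → ∃[ b ] π b ≡ v × dist a b ℕ.≤ 1
  follow a v (inj₁ e)        = a , e , ℕ.≤-trans (ℕ.≤-reflexive (dist-refl a)) z≤n
  follow a v (inj₂ (inj₁ e)) = a + 1ℤ , trans (sym (π-next a)) (sym e) , dist-suc a
  follow a v (inj₂ (inj₂ e)) = a - 1ℤ , π-next-injective a v e , dist-pred a

  -- Integers at distance 2 over adjacent vertices would make n a divisor of 1, 2 or 3.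
  tighten : ∀ {u v} a b → π a ≡ u → π b ≡ v → Adjacent u v → dist a b ℕ.≤ 2 → dist a b ℕ.≤ 1
  tighten a b refl refl adj d≤2 = go (follow a (π b) adj)
    where
    go : ∃[ c ] π c ≡ π b × dist a c ℕ.≤ 1 → dist a b ℕ.≤ 1
    go (c , e , d≤1) = subst (λ b → dist a b ℕ.≤ 1) (sym b≡c) d≤1
      where
      b≡c : b ≡ c
      b≡c = π-injective b c (sym e) (s≤s (ℕ.≤-trans (dist-triangle b a c (dist-flip a b d≤2) d≤1) 3≤p))

  Lift : ∀ {v e} (𝔸 : Digraph v e) → (Vertex 𝔸 → Fin n) → Set _
  Lift 𝔸 f = Σ[ F ∈ (Vertex 𝔸 → ℤ) ] (∀ x → π (F x) ≡ f x) × (∀ {x y} → Arc 𝔸 x y → dist (F x) (F y) ℕ.≤ 1)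

  LoopLift : (Fin n → Fin n) → Set
  LoopLift φ = Σ[ Φ ∈ (Fin n → ℤ) ] (∀ u → π (Φ u) ≡ φ u) × (∀ u → dist (Φ u) (Φ (next u)) ℕ.≤ 1)

  -- Rotations and reflections, the maps of winding number `ε`. Quantifying over all integers `a`
  -- avoids carries modulo n.
  Wound : (Fin n → Fin n) → Set
  Wound φ = ∃[ c ] ∃[ ε ] Unit ε × (∀ a → φ (π a) ≡ π (c + ε * a))

  LoopLift-resp : ∀ {φ ψ} → (∀ u → φ u ≡ ψ u) → LoopLift φ → LoopLift ψ
  LoopLift-resp e (Φ , over , near) = Φ , (λ u → trans (over u) (e u)) , near

  Wound-resp : ∀ {φ ψ} → (∀ u → φ u ≡ ψ u) → Wound φ → Wound ψ
  Wound-resp e (c , ε , unit , eq) = c , ε , unit , λ a → trans (sym (e (π a))) (eq a)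

  next-π : ∀ m → next (π (+ m)) ≡ π (+ suc m)
  next-π m = trans (π-next (+ m)) (cong π (ℤ.+-comm (+ m) 1ℤ))

  -- `height` unrolls φ along 0, 1, 2, ... in the cover. Whether it returns to its start after n
  -- steps decides between the two outcomes.
  module _ (φ : Fin n → Fin n) (height : ℕ → ℤ) (over : ∀ m → π (height m) ≡ φ (π (+ m)))
           (near : ∀ m → dist (height m) (height (suc m)) ℕ.≤ 1) where

    private
      height-over : ∀ u → π (height (toℕ u)) ≡ φ u
      height-over u = trans (over (toℕ u)) (cong φ (π-toℕ u))

      height-Lipschitz : ∀ m k → dist (height m) (height (m ℕ.+ k)) ℕ.≤ k
      height-Lipschitz m zero    rewrite ℕ.+-identityʳ m = ℕ.≤-reflexive (dist-refl (height m))
      height-Lipschitz m (suc k) rewrite ℕ.+-suc m k = ℕ.≤-trans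
        (dist-triangle (height m) (height (m ℕ.+ k)) _ (height-Lipschitz m k) (near (m ℕ.+ k)))
        (ℕ.≤-reflexive (ℕ.+-comm k 1))

      closed : height n ≡ height 0 → LoopLift φ
      closed eq = height ∘ toℕ , height-over , λ u → step u (ℕ.m≤n⇒m<n∨m≡n (Fin.toℕ<n u))
        where
        toℕ-next : ∀ u → toℕ (next u) ≡ suc (toℕ u) ℕ.% n
        toℕ-next u = Fin.toℕ-fromℕ< (ℕ.m%n<n (suc (toℕ u)) n)
        step : ∀ u → suc (toℕ u) ℕ.< n ⊎ suc (toℕ u) ≡ n →
               dist (height (toℕ u)) (height (toℕ (next u))) ℕ.≤ 1
        step u (inj₁ l) = subst (λ k → dist (height (toℕ u)) (height k) ℕ.≤ 1)
          (sym (trans (toℕ-next u) (ℕ.m<n⇒m%n≡m l))) (near (toℕ u))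
        step u (inj₂ e) = subst (λ h → dist (height (toℕ u)) h ℕ.≤ 1)
          (trans (cong height e) (trans eq (cong height (sym (trans (toℕ-next u) (trans (cong (ℕ._% n) e) (ℕ.n%n≡0 n)))))))
          (near (toℕ u))

      -- Both ends lie over the same vertex, so they differ by `q * n` with `q` nonzero. As n unit
      -- steps cover at most n, `q` is 1 or -1 and no step can be wasted: every height in between is
      -- forced.
      open-ended : height n ≢ height 0 → Wound φ
      open-ended ne = wound (π-injective-mod (height n) (height 0)
        (trans (over n) (trans (cong φ (π-cong (+ n) (+ 0) 1ℤ (one-period (+ n)))) (sym (over 0)))))
        where
        one-period : ∀ m → m ≡ 0ℤ + 1ℤ * m
        one-period = solve-∀
        wound : ∃[ q ] height n ≡ height 0 + q * + n → Wound φ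
        wound (q , eq) = height 0 , q , unit , winding
          where
          cancelled : ∀ a b m → a ≡ b + m → a - b ≡ m
          cancelled a b m e = trans (cong (_- b) e) (lemma b m)
            where
            lemma : ∀ b m → b + m - b ≡ m
            lemma = solve-∀
          ∣q∣≤1 : ∣ q ∣ ℕ.≤ 1
          ∣q∣≤1 = ℕ.*-cancelʳ-≤ ∣ q ∣ 1 n (subst₂ ℕ._≤_
            (trans (cong ∣_∣ (cancelled (height n) (height 0) _ eq)) (ℤ.∣i*j∣≡∣i∣*∣j∣ q (+ n)))
            (sym (ℕ.*-identityˡ n))
            (dist-flip (height 0) (height n) (height-Lipschitz 0 n)))
          unit : Unit q
          unit with ∣i∣≤1 q ∣q∣≤1
          ... | inj₁ refl = ⊥-elim (ne (trans eq (ℤ.+-identityʳ _)))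
          ... | inj₂ u    = u
          linear : ∀ m k → m ℕ.+ k ≡ n → height m ≡ height 0 + q * + m
          linear m k e = trans (undo (height m) (height 0)) (cong (_+_ (height 0))
            (taut (height m - height 0) m k unit (dist-flip (height 0) (height m) (height-Lipschitz 0 m)) above))
            where
            undo : ∀ a b → a ≡ b + (a - b)
            undo = solve-∀
            swap-sub : ∀ a b c → a - b - (c - b) ≡ a - c
            swap-sub = solve-∀
            above : dist (q * + (m ℕ.+ k)) (height m - height 0) ℕ.≤ k
            above = subst (ℕ._≤ k) (sym (trans
              (cong (λ y → dist y (height m - height 0))
                (trans (cong (λ j → q * + j) e) (sym (cancelled (height n) (height 0) _ eq))))
              (cong ∣_∣ (swap-sub (height n) (height 0) (height m)))))
              (subst (λ j → dist (height j) (height m) ℕ.≤ k) e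
                (dist-flip (height m) (height (m ℕ.+ k)) (height-Lipschitz m k)))
          winding : ∀ a → φ (π a) ≡ π (height 0 + q * a)
          winding a with quotient a
          ... | q′ , e = trans (sym (height-over (π a))) (trans
            (cong π (linear (toℕ (π a)) (n ℕ.∸ toℕ (π a)) (ℕ.m+[n∸m]≡n (ℕ.<⇒≤ (Fin.toℕ<n (π a))))))
            (sym (π-cong (height 0 + q * a) (height 0 + q * + toℕ (π a)) (q * q′)
              (trans (cong (λ a → height 0 + q * a) e) (regroup (height 0) q (+ toℕ (π a)) q′ (+ n))))))
            where
            regroup : ∀ h q r q′ n → h + q * (r + q′ * n) ≡ h + q * r + q * q′ * n
            regroup = solve-∀

    path-liftable-or-wound : LoopLift φ ⊎ Wound φ
    path-liftable-or-wound with height n ℤ.≟ height 0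
    ... | yes eq = inj₁ (closed eq)
    ... | no ne  = inj₂ (open-ended ne)

  liftable-or-wound : ∀ φ → (∀ u → Adjacent (φ u) (φ (next u))) → LoopLift φ ⊎ Wound φ
  liftable-or-wound φ φ-adj =
    path-liftable-or-wound φ (proj₁ ∘ path) (proj₂ ∘ path) (λ m → proj₂ (proj₂ (path-step m (path m))))
    where
    Over : ℕ → Set
    Over m = ∃[ b ] π b ≡ φ (π (+ m))
    path-step : ∀ m (x : Over m) → ∃[ b ] π b ≡ φ (π (+ suc m)) × dist (proj₁ x) b ℕ.≤ 1
    path-step m (a , e) = follow a _ (subst₂ Adjacent (sym e) (cong φ (next-π m)) (φ-adj (π (+ m))))
    path : ∀ m → Over m
    path zero    = + toℕ (φ (π (+ 0))) , π-toℕ _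
    path (suc m) = proj₁ (path-step m (path m)) , proj₁ (proj₂ (path-step m (path m)))

  -- Endomorphisms of the cycle and the arcs between them.

  module _ {e : Level} (𝔾 : Cycle n e) where
    open Cycle 𝔾

    Endo : (Fin n → Fin n) → Set _
    Endo φ = ∀ {u v} → u ⟶ v → φ u ⟶ φ v

    -- The arc relation of the exponential digraph of 𝔾 by itself; `Endo φ` says that φ has a loop
    -- there.
    _⇛_ : (φ ψ : Fin n → Fin n) → Set _
    φ ⇛ ψ = ∀ {u v} → u ⟶ v → φ u ⟶ ψ v

    consecutive-adjacent : ∀ {φ} → Endo φ → ∀ u → Adjacent (φ u) (φ (next u))
    consecutive-adjacent hom u with consecutive u
    ... | inj₁ a = noOthers (hom a)
    ... | inj₂ a = Adjacent-sym (noOthers (hom a))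

    consecutive-π : ∀ {η} a → Unit η → (π a ⟶ π (a + η)) ⊎ (π (a + η) ⟶ π a)
    consecutive-π a (inj₁ refl) = subst (λ v → (π a ⟶ v) ⊎ (v ⟶ π a)) (π-next a) (consecutive (π a))
    consecutive-π a (inj₂ refl) = swap (subst (λ v → (π (a - 1ℤ) ⟶ v) ⊎ (v ⟶ π (a - 1ℤ)))
      (trans (π-next (a - 1ℤ)) (cong π (lemma a))) (consecutive (π (a - 1ℤ))))
      where
      lemma : ∀ a → a - 1ℤ + 1ℤ ≡ a
      lemma = solve-∀

    -- The values of Φ and Ψ at `u` and `next u` form a square. An arc between `u` and `next u`,
    -- sent through `φ ⇛ ψ`, gives a diagonal, and `tighten` closes the two triangles in turn.
    parallel : ∀ {φ ψ} → φ ⇛ ψ → (Φ : LoopLift φ) (Ψ : LoopLift ψ) →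
               dist (proj₁ Φ zero) (proj₁ Ψ zero) ℕ.≤ 1 →
               ∀ u → dist (proj₁ Φ u) (proj₁ Ψ u) ℕ.≤ 1
    parallel {φ} {ψ} φ⇛ψ (Φ , Φ-over , Φ-near) (Ψ , Ψ-over , Ψ-near) base = next-induction _ base step
      where
      step : ∀ u → dist (Φ u) (Ψ u) ℕ.≤ 1 → dist (Φ (next u)) (Ψ (next u)) ℕ.≤ 1
      step u close = tighten _ _ (Φ-over u⁺) (Ψ-over u⁺) (noOthers (φ⇛ψ loops)) (diagonal (consecutive u))
        where
        u⁺ = next u
        diagonal : (u ⟶ u⁺) ⊎ (u⁺ ⟶ u) → dist (Φ u⁺) (Ψ u⁺) ℕ.≤ 2
        diagonal (inj₁ a) = dist-triangle (Φ u⁺) (Φ u) (Ψ u⁺) (dist-flip (Φ u) _ (Φ-near u))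
          (tighten _ _ (Φ-over u) (Ψ-over u⁺) (noOthers (φ⇛ψ a))
            (dist-triangle (Φ u) (Ψ u) (Ψ u⁺) close (Ψ-near u)))
        diagonal (inj₂ a) = dist-triangle (Φ u⁺) (Ψ u) (Ψ u⁺)
          (tighten _ _ (Φ-over u⁺) (Ψ-over u) (noOthers (φ⇛ψ a))
            (dist-triangle (Φ u⁺) (Φ u) (Ψ u) (dist-flip (Φ u) _ (Φ-near u)) close))
          (Ψ-near u)

    module _ {φ ψ : Fin n → Fin n} (φ-hom : Endo φ) (ψ-hom : Endo ψ) (φ⇛ψ : φ ⇛ ψ) where

      -- σ inverts φ.  Suppose ψ exceeds φ by η at one vertex.  Then no arc runs from σ (x - η) to σ x, so
      -- the reverse arc does, and ψ exceeds φ by η at σ (x - η) as well, hence everywhere.  Now φ provides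
      -- all arcs from y to y - η, and φ ⇛ ψ all arcs from y to y + η, among them the forbidden ones.
      module Shifted (c ε η : ℤ) (ε-unit : Unit ε) (η-unit : Unit η)
                     (φ-wound : ∀ a → φ (π a) ≡ π (c + ε * a)) where
        σ : ℤ → Fin n
        σ x = π (ε * (x - c))

        φσ : ∀ x → φ (σ x) ≡ π x
        φσ x = trans (φ-wound (ε * (x - c))) (cong π (begin
          c + ε * (ε * (x - c))   ≡⟨ regroup c ε x ⟩
          c + ε * ε * (x - c)     ≡⟨ cong (λ s → c + s * (x - c)) (Unit-square ε-unit) ⟩
          c + 1ℤ * (x - c)        ≡⟨ undo c x ⟩
          x                       ∎))
          where
          open ≡-Reasoning
          regroup : ∀ c ε x → c + ε * (ε * (x - c)) ≡ c + ε * ε * (x - c)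
          regroup = solve-∀
          undo : ∀ c x → c + 1ℤ * (x - c) ≡ x
          undo = solve-∀

        σ-shift : ∀ x ζ → σ (x + ζ) ≡ π (ε * (x - c) + ε * ζ)
        σ-shift x ζ = cong π (lemma ε x c ζ)
          where
          lemma : ∀ ε x c ζ → ε * (x + ζ - c) ≡ ε * (x - c) + ε * ζ
          lemma = solve-∀

        -- The bound n ≥ 4 enters through `tighten`, which would shrink the distance 2 to 1.
        no-arc-of-length-two : ∀ {u v} x → ¬ (π x ≡ u × π (x + (η + η)) ≡ v × u ⟶ v)
        no-arc-of-length-two x (eu , ev , a) = two≰one η-unit (subst (ℕ._≤ 1) (dist-shift x (η + η))
          (tighten x (x + (η + η)) eu ev (noOthers a) (ℕ.≤-reflexive (trans (dist-shift x (η + η)) (two η-unit)))))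
          where
          two : ∀ {η} → Unit η → ∣ η + η ∣ ≡ 2
          two (inj₁ refl) = refl
          two (inj₂ refl) = refl
          two≰one : ∀ {η} → Unit η → ¬ (∣ η + η ∣ ℕ.≤ 1)
          two≰one (inj₁ refl) (s≤s ())
          two≰one (inj₂ refl) (s≤s ())

        Moved : ℤ → Set
        Moved x = ψ (σ x) ≡ π (x + η)

        no-backward-arc : ∀ x → Moved x → ¬ (σ (x - η) ⟶ σ x)
        no-backward-arc x moved a = no-arc-of-length-two (x - η)
          (sym (φσ (x - η)) , trans (cong π (lemma x η)) (sym moved) , φ⇛ψ a)
          where
          lemma : ∀ x η → x - η + (η + η) ≡ x + η
          lemma = solve-∀

        forward-arc : ∀ x → Moved x → σ x ⟶ σ (x - η)
        forward-arc x moved with consecutive-π (ε * (x - c)) (Unit-* ε-unit (Unit-neg η-unit))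
        ... | inj₁ a = subst (σ x ⟶_) (sym (σ-shift x (- η))) a
        ... | inj₂ a = ⊥-elim (no-backward-arc x moved (subst (_⟶ σ x) (sym (σ-shift x (- η))) a))

        -- Let `d` lift `ψ (σ (x - η))` next to `x + η`. The forward arc sent through `φ ⇛ ψ` brings
        -- `d` within 1 of `x`, and then the loop at `σ (x - η)` brings it within 1 of `x - η`. Only
        -- `d = x` is within 1 of both `x + η` and `x - η`.
        propagate : ∀ x → Moved x → Moved (x - η)
        propagate x moved with follow (x + η) (ψ (σ (x - η)))
                                 (subst (λ u → Adjacent u (ψ (σ (x - η)))) moved (noOthers (ψ-hom (forward-arc x moved))))
        ... | d , over , near = trans (sym over) (cong π d≡)
          where
          x-d : dist x d ℕ.≤ 1
          x-d = tighten x d (sym (φσ x)) over (noOthers (φ⇛ψ (forward-arc x moved)))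
            (dist-triangle x (x + η) d (ℕ.≤-reflexive (trans (dist-shift x η) (∣Unit∣ η-unit))) near)
          below : dist (x - η) d ℕ.≤ 1
          below = tighten (x - η) d (sym (φσ (x - η))) over (noOthers (φ⇛ψ loops))
            (dist-triangle (x - η) x d (ℕ.≤-reflexive (trans (dist-sym (x - η) x)
              (trans (dist-shift x (- η)) (∣Unit∣ (Unit-neg η-unit))))) x-d)
          swap₁ : ∀ x η d → x + η - d ≡ x - d + η
          swap₁ = solve-∀
          swap₂ : ∀ x η d → x - η - d ≡ x - d - η
          swap₂ = solve-∀
          undo : ∀ x η → x ≡ x - η + η
          undo = solve-∀
          d≡ : d ≡ x - η + η
          d≡ = trans (sym (ℤ.i-j≡0⇒i≡j x d (between (x - d) η-unit
                 (subst (λ y → ∣ y ∣ ℕ.≤ 1) (swap₁ x η d) near)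
                 (subst (λ y → ∣ y ∣ ℕ.≤ 1) (swap₂ x η d) below)))) (undo x η)

        propagate* : ∀ x → Moved x → ∀ m → Moved (x - η * + m)
        propagate* x moved zero    = subst Moved (lemma x η) moved
          where
          lemma : ∀ x η → x ≡ x - η * 0ℤ
          lemma = solve-∀
        propagate* x moved (suc m) = subst Moved (lemma x η (+ m)) (propagate (x - η * + m) (propagate* x moved m))
          where
          lemma : ∀ x η m → x - η * m - η ≡ x - η * (1ℤ + m)
          lemma = solve-∀

        Moved-periodic : ∀ x y q → y ≡ x + q * + n → Moved x → Moved y
        Moved-periodic x y q e moved = trans (cong ψ (π-cong (ε * (y - c)) (ε * (x - c)) (ε * q)
            (trans (cong (λ y → ε * (y - c)) e) (lemma₁ ε x q (+ n) c))))
          (trans moved (sym (π-cong (y + η) (x + η) q (trans (cong (_+ η) e) (lemma₂ x q (+ n) η)))))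
          where
          lemma₁ : ∀ ε x q n c → ε * (x + q * n - c) ≡ ε * (x - c) + ε * q * n
          lemma₁ = solve-∀
          lemma₂ : ∀ x q n η → x + q * n + η ≡ x + η + q * n
          lemma₂ = solve-∀

        -- Propagation moves only by `- η`, but going round the cycle with `Moved-periodic` reaches
        -- every integer.
        everywhere : ∀ x → Moved x → ∀ y → Moved y
        everywhere x moved y = go η-unit
          where
          reach⁻ : ∀ m q → y ≡ x - η * + m + q * + n → Moved y
          reach⁻ m q e = Moved-periodic (x - η * + m) y q e (propagate* x moved m)
          lemma₁ : ∀ x y m n q → x ≡ y + m + q * n → y ≡ x - 1ℤ * m + (- q) * n
          lemma₁ x y m n q refl = lemma y m n q
            where
            lemma : ∀ y m n q → y ≡ y + m + q * n - 1ℤ * m + (- q) * n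
            lemma = solve-∀
          lemma₂ : ∀ x y m n q → y ≡ x + m + q * n → y ≡ x - -1ℤ * m + q * n
          lemma₂ x y m n q refl = lemma x m n q
            where
            lemma : ∀ x m n q → x + m + q * n ≡ x - -1ℤ * m + q * n
            lemma = solve-∀
          go : Unit η → Moved y
          go (inj₁ η≡) with π-surjective-above y (π x)
          ... | m , _ , e with π-injective-mod x (y + + m) e
          ...   | q , e′ = reach⁻ m (- q)
                    (subst (λ η → y ≡ x - η * + m + (- q) * + n) (sym η≡) (lemma₁ x y (+ m) (+ n) q e′))
          go (inj₂ η≡) with π-surjective-above x (π y)
          ... | m , _ , e with π-injective-mod y (x + + m) e
          ...   | q , e′ = reach⁻ m q
                    (subst (λ η → y ≡ x - η * + m + q * + n) (sym η≡) (lemma₂ x y (+ m) (+ n) q e′))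

        never-moved : ∀ x → ¬ Moved x
        never-moved x moved = no-backward-arc x moved
          (subst₂ _⟶_ (sym (σ-shift x (- η))) (cong π (lemma₃ (ε * (x - c)) ε η)) (any-arc (Unit-* ε-unit η-unit) _))
          where
          all = everywhere x moved
          lemma₁ : ∀ y η → y + η - η ≡ y
          lemma₁ = solve-∀
          lemma₃ : ∀ y ε η → y + ε * (- η) + ε * η ≡ y
          lemma₃ = solve-∀
          down : ∀ y → π y ⟶ π (y - η)
          down y = subst₂ _⟶_ (φσ y) (φσ (y - η)) (φ-hom (forward-arc y (all y)))
          up : ∀ y → π y ⟶ π (y + η)
          up y = subst₂ _⟶_ (φσ y) (all y) (φ⇛ψ loops)
          -- The forbidden arc is a step by `ε * η`, which may be `η` or `- η`, so both `up` and
          -- `down` are needed.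
          any-arc : ∀ {ζ} → Unit ζ → ∀ y → π y ⟶ π (y + ζ)
          any-arc u y = pick η-unit u
            where
            pick : ∀ {ζ} → Unit η → Unit ζ → π y ⟶ π (y + ζ)
            pick (inj₁ e) (inj₁ refl) = subst (λ η → π y ⟶ π (y + η)) e (up y)
            pick (inj₁ e) (inj₂ refl) = subst (λ η → π y ⟶ π (y - η)) e (down y)
            pick (inj₂ e) (inj₁ refl) = subst (λ η → π y ⟶ π (y - η)) e (down y)
            pick (inj₂ e) (inj₂ refl) = subst (λ η → π y ⟶ π (y + η)) e (up y)

      -- The arc from `φ u` to `ψ u` lifts to a step of length at most 1. If that step is not 0, it
      -- serves as the `η` of `Shifted`, with `u` written as `σ x`.
      wound-isolated : Wound φ → ∀ u → φ u ≡ ψ u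
      wound-isolated (c , ε , ε-unit , φ-wound) u
        with follow (c + ε * + toℕ u) (ψ u) (noOthers (subst (_⟶ ψ u)
               (trans (cong φ (sym (π-toℕ u))) (φ-wound (+ toℕ u))) (φ⇛ψ loops)))
      ... | b , over , near with ∣i∣≤1 (b - (c + ε * + toℕ u)) (dist-flip (c + ε * + toℕ u) b near)
      ...   | inj₁ b≡ = trans (trans (cong φ (sym (π-toℕ u))) (φ-wound (+ toℕ u)))
                          (trans (cong π (sym (ℤ.i-j≡0⇒i≡j b _ b≡))) over)
      ...   | inj₂ unit = ⊥-elim (never-moved x (trans (cong ψ (trans (cong π σ-inverse) (π-toℕ u)))
                            (trans (sym over) (cong π (undo b x)))))
        where
        x = c + ε * + toℕ u
        open Shifted c ε (b - x) ε-unit unit φ-wound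
        undo : ∀ b x → b ≡ x + (b - x)
        undo = solve-∀
        regroup : ∀ ε c a → ε * (c + ε * a - c) ≡ ε * ε * a
        regroup = solve-∀
        σ-inverse : ε * (x - c) ≡ + toℕ u
        σ-inverse = trans (regroup ε c (+ toℕ u))
          (trans (cong (_* + toℕ u) (Unit-square ε-unit)) (ℤ.*-identityˡ _))

  -- Polymorphisms: a lift to the cover or a single essential coordinate.

  rebase : ∀ {φ} → LoopLift φ → ∀ h → π h ≡ φ zero → Σ[ Φ ∈ LoopLift φ ] proj₁ Φ zero ≡ h
  rebase {φ} (Φ , over , near) h h-over with π-injective-mod h (Φ zero) (trans h-over (sym (over zero)))
  ... | q , e = (Φ′ , over′ , near′) , sym e
    where
    -- Translation by a multiple of n is a deck transformation, so it takes lifts to lifts.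
    Φ′ : Fin n → ℤ
    Φ′ u = Φ u + q * + n
    over′ : ∀ u → π (Φ′ u) ≡ φ u
    over′ u = trans (π-cong (Φ′ u) (Φ u) q refl) (over u)
    cancel : ∀ a b m → a + m - (b + m) ≡ a - b
    cancel = solve-∀
    near′ : ∀ u → dist (Φ′ u) (Φ′ (next u)) ℕ.≤ 1
    near′ u = subst (λ d → ∣ d ∣ ℕ.≤ 1) (sym (cancel (Φ u) (Φ (next u)) (q * + n))) (near u)

  module _ {e : Level} (𝔾 : Cycle n e) where
    open Cycle 𝔾

    connected : ∀ u v → EqClosure _⟶_ u v
    connected u v = EqClosure.symmetric _⟶_ (from-zero u) ◅◅ from-zero v
      where
      from-zero : ∀ u → EqClosure _⟶_ zero u
      from-zero = next-induction _ Star.ε λ u path → path ◅◅ step (consecutive u) ◅ Star.ε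
        where
        step : ∀ {u v} → (u ⟶ v) ⊎ (v ⟶ u) → SymClosure _⟶_ u v
        step (inj₁ a) = fwd a
        step (inj₂ a) = bwd a

    power-connected : ∀ {k} (xs ys : Vec (Fin n) k) → EqClosure (Pointwise _⟶_) xs ys
    power-connected []       []       = Star.ε
    power-connected (x ∷ xs) (y ∷ ys) =
      EqClosure.gmap (_∷ xs) (_∷ Pointwise.refl loops) (connected x y) ◅◅
      EqClosure.gmap (y ∷_) (loops ∷_) (power-connected xs ys)

    module _ {a ℓ} {A : Set a} {_⇝_ : Rel A ℓ} (⇝-refl : Reflexive _⇝_)
             (φ : A → Fin n → Fin n) (φ-mono : ∀ {x y} → x ⇝ y → _⇛_ 𝔾 (φ x) (φ y)) where

      -- The family φ is a homomorphism from a reflexive digraph into the exponential. Isolation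
      -- carries equality, and with it the winding, along each arc; a backward arc is an arc for the
      -- `opposite` cycle.
      wound-constant : ∀ {x y} → EqClosure _⇝_ x y → Wound (φ x) → ∀ u → φ x u ≡ φ y u
      wound-constant Star.ε wound u = refl
      wound-constant {x} (_◅_ {j = z} (fwd a) path) wound u =
        trans (eq u) (wound-constant path (Wound-resp eq wound) u)
        where
        eq : ∀ u → φ x u ≡ φ z u
        eq = wound-isolated 𝔾 (φ-mono ⇝-refl) (φ-mono ⇝-refl) (φ-mono a) wound
      wound-constant {x} (_◅_ {j = z} (bwd a) path) wound u =
        trans (eq u) (wound-constant path (Wound-resp eq wound) u)
        where
        eq : ∀ u → φ x u ≡ φ z u
        eq = wound-isolated (opposite 𝔾) (φ-mono ⇝-refl) (φ-mono ⇝-refl) (φ-mono a) wound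

    -- The lift `h` of the slice with head `zero` prescribes where the lift of each line in the
    -- first direction starts. Lines over adjacent tails then start close together, and `parallel`
    -- keeps them close.
    lift-cons : ∀ {k} (f : Vec (Fin n) (suc k) → Fin n) → IsPolymorphism digraph (suc k) f →
                (∀ ys → LoopLift (λ x → f (x ∷ ys))) → Lift (power digraph k) (f ∘ (zero ∷_)) →
                Lift (power digraph (suc k)) f
    lift-cons f hom line (h , h-over , h-near) = F , over , near
      where
      based : ∀ ys → Σ[ Φ ∈ LoopLift (λ x → f (x ∷ ys)) ] proj₁ Φ zero ≡ h ys
      based ys = rebase (line ys) (h ys) (h-over ys)
      F : Vec (Fin n) (suc _) → ℤ
      F (x ∷ ys) = proj₁ (proj₁ (based ys)) x
      over : ∀ xs → π (F xs) ≡ f xs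
      over (x ∷ ys) = proj₁ (proj₂ (proj₁ (based ys))) x
      horizontal : ∀ {x y} ys → Adjacent x y → dist (F (x ∷ ys)) (F (y ∷ ys)) ℕ.≤ 1
      horizontal {x} ys (inj₁ refl)  = ℕ.≤-trans (ℕ.≤-reflexive (dist-refl (F (x ∷ ys)))) z≤n
      horizontal {x} ys (inj₂ (inj₁ refl)) = proj₂ (proj₂ (proj₁ (based ys))) x
      horizontal {y = y} ys (inj₂ (inj₂ refl)) = dist-flip (F (y ∷ ys)) _ (proj₂ (proj₂ (proj₁ (based ys))) y)
      vertical : ∀ x {ys zs} → Pointwise _⟶_ ys zs → dist (F (x ∷ ys)) (F (x ∷ zs)) ℕ.≤ 1
      vertical x {ys} {zs} as = parallel 𝔾 (λ a → hom (a ∷ as)) (proj₁ (based ys)) (proj₁ (based zs))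
        (subst₂ (λ a b → dist a b ℕ.≤ 1) (sym (proj₂ (based ys))) (sym (proj₂ (based zs))) (h-near as)) x
      near : ∀ {xs ys} → Pointwise _⟶_ xs ys → dist (F xs) (F ys) ℕ.≤ 1
      -- Crossing to the parallel line and then moving along it gives the bound 2; the arc between
      -- the images tightens it to 1.
      near {x ∷ xs} {y ∷ ys} (a ∷ as) = tighten (F (x ∷ xs)) (F (y ∷ ys)) (over (x ∷ xs)) (over (y ∷ ys))
        (noOthers (hom (a ∷ as)))
        (dist-triangle (F (x ∷ xs)) (F (x ∷ ys)) (F (y ∷ ys)) (vertical x as) (horizontal ys (noOthers a)))

    update-Pointwise : ∀ {k} {xs ys : Vec (Fin n) k} {u v} (i : Fin k) →
                       Pointwise _⟶_ xs ys → u ⟶ v → Pointwise _⟶_ (xs [ i ]≔ u) (ys [ i ]≔ v)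
    update-Pointwise zero    (_ ∷ as) b = b ∷ as
    update-Pointwise (suc i) (a ∷ as) b = a ∷ update-Pointwise i as b

    -- `Wound g` is kept because `depends-on-tail` needs a wound line to start from.
    DependsOn : ∀ {k} → Fin k → (Vec (Fin n) k → Fin n) → Set
    DependsOn i f = ∃[ g ] Wound g × (∀ xs → f xs ≡ g (lookup xs i))

    depends-on-head : ∀ {k} (f : Vec (Fin n) (suc k) → Fin n) → IsPolymorphism digraph (suc k) f →
                      ∀ ys → Wound (λ x → f (x ∷ ys)) → DependsOn zero f
    depends-on-head f hom ys wound = _ , wound , λ { (x ∷ zs) →
      sym (wound-constant (Pointwise.refl loops) (λ ys x → f (x ∷ ys)) (λ as a → hom (a ∷ as))
        (power-connected ys zs) wound x) }

    -- Here the head `x` is the parameter, and the line runs in direction `i` through `ys`. At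
    -- `x = zero` this line is the wound map `g`, so by isolation it is the same for every `x`.
    depends-on-tail : ∀ {k} (f : Vec (Fin n) (suc k) → Fin n) → IsPolymorphism digraph (suc k) f →
                      ∀ i → DependsOn i (f ∘ (zero ∷_)) → DependsOn (suc i) f
    depends-on-tail f hom i (g , wound , eq) = g , wound , λ { (x ∷ ys) → trans
      (subst (λ zs → f (x ∷ zs) ≡ f (zero ∷ zs)) ([]≔-lookup ys i)
        (sym (wound-constant loops (λ x z → f (x ∷ ys [ i ]≔ z))
          (λ a b → hom (a ∷ update-Pointwise i (Pointwise.refl loops) b)) (connected zero x)
          (Wound-resp (λ z → sym (trans (eq (ys [ i ]≔ z)) (cong g (lookup∘update i ys z)))) wound)
          (lookup ys i))))
      (eq ys) }

    -- Induction through the slice with head `zero`. If the slice depends on one coordinate, so does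
    -- f; if it lifts, the line in the first direction over the all-`zero` tail decides.
    lift-or-depends : ∀ k (f : Vec (Fin n) k → Fin n) → IsPolymorphism digraph k f →
                      Lift (power digraph k) f ⊎ ∃[ i ] DependsOn i f
    lift-or-depends zero f hom = inj₁ ((λ _ → + toℕ (f [])) , (λ { [] → π-toℕ (f []) }) ,
      λ _ → ℕ.≤-trans (ℕ.≤-reflexive (dist-refl (+ toℕ (f [])))) z≤n)
    lift-or-depends (suc k) f hom with lift-or-depends k (f ∘ (zero ∷_)) (λ as → hom (loops ∷ as))
    ... | inj₂ (i , dep) = inj₂ (suc i , depends-on-tail f hom i dep)
    ... | inj₁ lift = go (line (replicate k zero))
      where
      line : ∀ ys → LoopLift (λ x → f (x ∷ ys)) ⊎ Wound (λ x → f (x ∷ ys))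
      line ys = liftable-or-wound _ (consecutive-adjacent 𝔾 (λ a → hom (a ∷ Pointwise.refl loops)))
      go : LoopLift (λ x → f (x ∷ replicate k zero)) ⊎ Wound (λ x → f (x ∷ replicate k zero)) →
           Lift (power digraph (suc k)) f ⊎ ∃[ i ] DependsOn i f
      go (inj₂ wound) = inj₂ (zero , depends-on-head f hom _ wound)
      go (inj₁ base)  = inj₁ (lift-cons f hom (λ ys → other ys (line ys)) lift)
        where
        other : ∀ ys → LoopLift (λ x → f (x ∷ ys)) ⊎ Wound (λ x → f (x ∷ ys)) → LoopLift (λ x → f (x ∷ ys))
        other ys (inj₁ l)     = l
        -- By isolation a wound line coincides with the base line, and that one lifts.
        other ys (inj₂ wound) = LoopLift-resp
          (λ x → sym (wound-constant (Pointwise.refl loops) (λ ys x → f (x ∷ ys)) (λ as a → hom (a ∷ as))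
            (power-connected ys (replicate k zero)) wound x)) base

-- Arcs need not be decidable. But non-surjectivity is a negation, so the finitely many case
-- distinctions on them can be made under a double negation.
¬¬-decidable : ∀ {ℓ n} (P : Fin n → Set ℓ) → ¬ ¬ (∀ i → Dec (P i))
¬¬-decidable P = Fin.sequence (RawMonad.rawApplicative ¬¬-Monad) (λ i → ¬¬-excluded-middle)

-- Words of arc directions.

alternating : Bool → ℕ → List Bool
alternating s zero    = []
alternating s (suc m) = s ∷ alternating (not s) m

data Alternating : ℕ → List Bool → Set where
  alternating-from : ∀ s m → Alternating m (alternating s m)

data Blocks : ℕ → List Bool → Set where
  []    : Blocks 0 []
  block : ∀ s {m w} → Blocks m w → Blocks (suc m) (s ∷ not s ∷ w)

-- The index is a cost, counting letters for `Alternating` and blocks for `Blocks`. Walks are joined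
-- end to end, so a word has to split at every intermediate cost.
Splits : (ℕ → List Bool → Set) → Set
Splits K = ∀ a {b w} → K (a ℕ.+ b) w → ∃[ w₁ ] ∃[ w₂ ] w ≡ w₁ ++ w₂ × K a w₁ × K b w₂

Alternating-splits : Splits Alternating
Alternating-splits a {b} (alternating-from s _) with go a s
  where
  go : ∀ a s → ∃[ t ] alternating s (a ℕ.+ b) ≡ alternating s a ++ alternating t b
  go zero    s = s , refl
  go (suc a) s with go a (not s)
  ... | t , e = t , cong (s ∷_) e
... | t , e = _ , _ , e , alternating-from s a , alternating-from t b

Blocks-splits : Splits Blocks
Blocks-splits zero    k           = [] , _ , refl , [] , k
Blocks-splits (suc a) (block s k) with Blocks-splits a k
... | w₁ , w₂ , e , k₁ , k₂ = s ∷ not s ∷ w₁ , w₂ , cong (λ w → s ∷ not s ∷ w) e , block s k₁ , k₂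

-- Walks along words and their height in the cover, with `q` equal to n - 2.

module LiftRange (q : ℕ) (2≤q : 2 ℕ.≤ q) where
  open Lifting (suc q) (s≤s 2≤q) public

  module _ {e : Level} (𝔾 : Cycle n e) where
    open Cycle 𝔾

    Move : Bool → Rel (Fin n) e
    Move true  = _⟶_
    Move false = flip _⟶_

    Move-refl : ∀ s {u} → Move s u u
    Move-refl true  = loops
    Move-refl false = loops

    data Walk : List Bool → Rel (Fin n) e where
      []  : ∀ {u} → Walk [] u u
      _∷_ : ∀ {s w u v x} → Move s u v → Walk w v x → Walk (s ∷ w) u x

    Walk-++ : ∀ {w₁ w₂ u v x} → Walk w₁ u v → Walk w₂ v x → Walk (w₁ ++ w₂) u x
    Walk-++ []       walk = walk
    Walk-++ (m ∷ ms) walk = m ∷ Walk-++ ms walk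

    Walk-refl : ∀ w {u} → Walk w u u
    Walk-refl []      = []
    Walk-refl (s ∷ w) = Move-refl s ∷ Walk-refl w

    Bidirected : Fin n → Set e
    Bidirected u = (u ⟶ next u) × (next u ⟶ u)

    one-way : ∀ u → ¬ Bidirected u → ∃[ s ] ¬ Move s u (next u)
    one-way u ¬b with consecutive u
    ... | inj₁ a = false , λ b → ¬b (a , b)
    ... | inj₂ b = true , λ a → ¬b (a , b)

    -- One of the two letters has the right direction; a loop absorbs the other.
    two-letter-walk : ∀ s {u v} → (u ⟶ v) ⊎ (v ⟶ u) → Walk (s ∷ not s ∷ []) u v
    two-letter-walk true  (inj₁ a) = a ∷ loops ∷ []
    two-letter-walk true  (inj₂ a) = loops ∷ a ∷ []
    two-letter-walk false (inj₁ a) = loops ∷ a ∷ []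
    two-letter-walk false (inj₂ a) = a ∷ loops ∷ []

    -- Climb A w B: a walk with word w in the universal cover that starts at height
    -- at most A ends at height at most B.
    data Climb : ℤ → List Bool → ℤ → Set e where
      []   : ∀ {A} → Climb A [] A
      up   : ∀ {A s w B} → Climb (A + 1ℤ) w B → Climb A (s ∷ w) B
      stay : ∀ {A s w B} → ¬ Move s (π A) (π (A + 1ℤ)) → Climb A w B → Climb A (s ∷ w) B

    private
      raise : ∀ A m → A + 1ℤ + + m ≡ A + + suc m
      raise A m = ℤ.+-assoc A 1ℤ (+ m)

    climb-alternating : ∀ s m A → Climb A (alternating s m) (A + + m)
    climb-alternating s zero    A = subst (Climb A []) (sym (ℤ.+-identityʳ A)) []
    climb-alternating s (suc m) A = up (subst (Climb (A + 1ℤ) _) (raise A m) (climb-alternating (not s) m (A + 1ℤ)))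

    stay-put : ∀ A → ¬ Bidirected (π A) → ∃[ s ] ¬ Move s (π A) (π (A + 1ℤ))
    stay-put A ¬b with one-way (π A) ¬b
    ... | s , ¬m = s , ¬m ∘ subst (Move s (π A)) (sym (π-next A))

    -- In the second alternative the word has `suc m` letters but gains at most `m`: one letter is
    -- wasted at a one-way edge.
    BidirectedOrClimb : ℕ → ℤ → Set e
    BidirectedOrClimb m A = (∀ i → i ℕ.≤ m → Bidirected (π (A + + i))) ⊎
                            (∃[ s ] Climb A (alternating s (suc m)) (A + + m))

    climb-from-one-way : ∀ m A → ¬ Bidirected (π A) → BidirectedOrClimb m A
    climb-from-one-way m A ¬b = let s , ¬m = stay-put A ¬b in inj₂ (s , stay ¬m (climb-alternating (not s) m A))

    bidirected-then : ∀ m A → Bidirected (π A) → BidirectedOrClimb m (A + 1ℤ) → BidirectedOrClimb (suc m) A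
    bidirected-then m A b (inj₁ bs)      = inj₁ λ
      { zero    _       → subst (Bidirected ∘ π) (sym (ℤ.+-identityʳ A)) b
      ; (suc i) (s≤s l) → subst (Bidirected ∘ π) (raise A i) (bs i l) }
    bidirected-then m A b (inj₂ (s , c)) = inj₂ (not s , up (subst₂
      (λ s B → Climb (A + 1ℤ) (alternating s (suc m)) B) (sym (not-involutive s)) (raise A m) c))

    -- Scanning upwards from `A`, the first one-way edge determines the letter that is wasted there,
    -- and alternation then determines the letters before and after it.
    bidirected-or-climb : (∀ u → Dec (Bidirected u)) → ∀ m A → BidirectedOrClimb m A
    bidirected-or-climb dec zero    A = Sum.[ bidirected , climb-from-one-way 0 A ]′ (toSum (dec (π A)))
      where
      bidirected : Bidirected (π A) → BidirectedOrClimb 0 A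
      bidirected b = inj₁ λ { zero _ → subst (Bidirected ∘ π) (sym (ℤ.+-identityʳ A)) b }
    bidirected-or-climb dec (suc m) A =
      Sum.[ (λ b → bidirected-then m A b (bidirected-or-climb dec m (A + 1ℤ))) , climb-from-one-way (suc m) A ]′
        (toSum (dec (π A)))

    -- The first letter of each block is chosen against the edge at the current height, so only the
    -- second can gain.
    climb-blocks : (∀ u → ¬ Bidirected u) → ∀ m A → ∃[ w ] Blocks m w × Climb A w (A + + m)
    climb-blocks one-ways zero    A = [] , [] , subst (Climb A []) (sym (ℤ.+-identityʳ A)) []
    climb-blocks one-ways (suc m) A =
      let s , ¬m    = stay-put A (one-ways (π A))
          w , k , c = climb-blocks one-ways m (A + 1ℤ)
      in _ , block s k , stay ¬m (up (subst (Climb (A + 1ℤ) w) (raise A m) c))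

    -- The cost of joining two vertices by words of a family.

    module Reach (K : ℕ → List Bool → Set) (split : Splits K) where

      -- Every word of cost `m` has to work, because concatenation does not control which pieces
      -- `split` returns.
      Reach : ℕ → Fin n → Fin n → Set e
      Reach m u v = ∀ {w} → K m w → Walk w u v × Walk w v u

      Reach-sym : ∀ {m u v} → Reach m u v → Reach m v u
      Reach-sym r k = proj₂ (r k) , proj₁ (r k)

      Reach-refl : ∀ {m u} → Reach m u u
      Reach-refl {w = w} k = Walk-refl w , Walk-refl w

      concatenate : ∀ a {b u v x} → (∀ {w} → K a w → Walk w u v) → (∀ {w} → K b w → Walk w v x) →
                    ∀ {w} → K (a ℕ.+ b) w → Walk w u x
      concatenate a r s k with split a k
      ... | w₁ , w₂ , refl , k₁ , k₂ = Walk-++ (r k₁) (s k₂)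

      Reach-trans : ∀ {a b u v x} → Reach a u v → Reach b v x → Reach (a ℕ.+ b) u x
      Reach-trans {a} {b} r s {w} k =
        concatenate a (λ k → proj₁ (r k)) (λ k → proj₁ (s k)) k ,
        concatenate b (λ k → proj₂ (s k)) (λ k → proj₂ (r k)) (subst (λ m → K m w) (ℕ.+-comm a b) k)

      Reach-mono : ∀ {a b u v} → a ℕ.≤ b → Reach a u v → Reach b u v
      Reach-mono {a} {b} a≤b r = subst (λ m → Reach m _ _) (ℕ.m+[n∸m]≡n a≤b) (Reach-trans r (Reach-refl {b ℕ.∸ a}))

      Reach-path : ∀ c A m → (∀ i → i ℕ.< m → Reach c (π (A + + i)) (π (A + + suc i))) →
                   Reach (m ℕ.* c) (π A) (π (A + + m))
      Reach-path c A zero    edges = subst (Reach 0 (π A)) (cong π (sym (ℤ.+-identityʳ A))) Reach-refl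
      Reach-path c A (suc m) edges = Reach-trans
        (subst₂ (λ B C → Reach c (π B) (π C)) (ℤ.+-identityʳ A) refl (edges 0 (s≤s z≤n)))
        (subst (λ B → Reach (m ℕ.* c) (π (A + 1ℤ)) (π B)) (raise A m)
          (Reach-path c (A + 1ℤ) m λ i l →
            subst₂ (λ B C → Reach c (π B) (π C)) (sym (raise A i)) (sym (raise A (suc i))) (edges (suc i) (s≤s l))))

      Reach-segment : ∀ c A i d → (∀ j → j ℕ.< i ℕ.+ d → Reach c (π (A + + j)) (π (A + + suc j))) →
                      Reach (d ℕ.* c) (π (A + + i)) (π (A + + (i ℕ.+ d)))
      Reach-segment c A i d edges = subst (λ B → Reach (d ℕ.* c) (π (A + + i)) (π B)) (shift i d)
        (Reach-path c (A + + i) d λ j l → subst₂ (λ B C → Reach c (π B) (π C))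
          (sym (shift i j)) (trans (cong (λ k → A + + k) (sym (ℕ.+-suc i j))) (sym (shift i (suc j))))
          (edges (i ℕ.+ j) (ℕ.+-monoʳ-< i l)))
        where
        shift : ∀ i j → A + + i + + j ≡ A + + (i ℕ.+ j)
        shift i j = ℤ.+-assoc A (+ i) (+ j)

      -- The n vertices are listed upwards from `A`. On this path of n - 1 edges, `i`, `d` and `r`
      -- count the edges before, between and after the two vertices; symmetry of `Reach` settles the
      -- other order.
      Reach-everywhere : ∀ A m → (∀ i d r → i ℕ.+ d ℕ.+ r ≡ suc q → Reach m (π (A + + i)) (π (A + + (i ℕ.+ d)))) →
                         ∀ u v → Reach m u v
      Reach-everywhere A m ordered u v = locate (π-surjective-above A u) (π-surjective-above A v)
        where
        forward : ∀ {i j} → i ℕ.≤ j → j ℕ.≤ suc q → Reach m (π (A + + i)) (π (A + + j))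
        forward {i} {j} i≤j j≤ = subst (λ k → Reach m (π (A + + i)) (π (A + + k))) (ℕ.m+[n∸m]≡n i≤j)
          (ordered i (j ℕ.∸ i) (suc q ℕ.∸ j) (trans (cong (ℕ._+ (suc q ℕ.∸ j)) (ℕ.m+[n∸m]≡n i≤j)) (ℕ.m+[n∸m]≡n j≤)))
        locate : ∀ {u v} → ∃[ i ] i ℕ.< n × u ≡ π (A + + i) → ∃[ j ] j ℕ.< n × v ≡ π (A + + j) → Reach m u v
        locate (i , s≤s i≤ , refl) (j , s≤s j≤ , refl) =
          compare (ℕ.≤-total i j)
          where
          compare : i ℕ.≤ j ⊎ j ℕ.≤ i → Reach m (π (A + + i)) (π (A + + j))
          compare (inj₁ i≤j) = forward i≤j j≤
          compare (inj₂ j≤i) = Reach-sym (forward j≤i i≤)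

      Edge : ℕ → ℤ → ℕ → Set e
      Edge c A i = Reach c (π (A + + i)) (π (A + + suc i))

      -- Only the two ends of the path are more than `q` edges apart, and `wrap` joins these
      -- directly.
      reach-along-segment : ∀ A → (∀ i → i ℕ.≤ q → Edge 1 A i) → Reach q (π (A + + suc q)) (π A) →
                            ∀ u v → Reach q u v
      reach-along-segment A edges wrap = Reach-everywhere A q ordered
        where
        ordered : ∀ i d r → i ℕ.+ d ℕ.+ r ≡ suc q → Reach q (π (A + + i)) (π (A + + (i ℕ.+ d)))
        ordered i d r eq = go (ℕ.m≤n⇒m<n∨m≡n (ℕ.≤-trans (ℕ.m≤n+m d i) i+d≤))
          where
          i+d≤ : i ℕ.+ d ℕ.≤ suc q
          i+d≤ = ℕ.≤-trans (ℕ.m≤m+n (i ℕ.+ d) r) (ℕ.≤-reflexive eq)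
          go : d ℕ.< suc q ⊎ d ≡ suc q → Reach q (π (A + + i)) (π (A + + (i ℕ.+ d)))
          go (inj₁ (s≤s d≤q)) = Reach-mono (ℕ.≤-trans (ℕ.≤-reflexive (ℕ.*-identityʳ d)) d≤q)
            (Reach-segment 1 A i d λ j l → edges j (ℕ.≤-pred (ℕ.≤-trans l i+d≤)))
          go (inj₂ refl) with ℕ.n≤0⇒n≡0 (ℕ.+-cancelʳ-≤ (suc q) i 0 i+d≤)
          ... | refl = subst (λ B → Reach q (π B) (π (A + + suc q))) (sym (ℤ.+-identityʳ A)) (Reach-sym wrap)

      reach-with-shortcut : ∀ A → (∀ i → Edge 2 A i) → Reach 1 (π (A + + suc q)) (π A) →
                            ∀ u v → Reach (suc q) u v
      reach-with-shortcut A edges wrap = Reach-everywhere A (suc q) ordered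
        where
        ordered : ∀ i d r → i ℕ.+ d ℕ.+ r ≡ suc q → Reach (suc q) (π (A + + i)) (π (A + + (i ℕ.+ d)))
        ordered i d r eq with d ℕ.* 2 ℕ.≤? suc q
        ... | yes short = Reach-mono short (Reach-segment 2 A i d λ j _ → edges j)
        ... | no long   = Reach-mono cost
          -- The way round goes down to `A`, through `wrap` to the top of the path, and down to the
          -- target.
          (Reach-trans (Reach-sym (Reach-path 2 A i λ j _ → edges j))
            (Reach-trans (Reach-sym wrap) (Reach-sym
              (subst (λ k → Reach (r ℕ.* 2) (π (A + + (i ℕ.+ d))) (π (A + + k))) eq
                (Reach-segment 2 A (i ℕ.+ d) r λ j _ → edges j)))))
          where
          double : ∀ i d r → i ℕ.* 2 ℕ.+ (1 ℕ.+ r ℕ.* 2) ℕ.+ d ℕ.* 2 ≡ (i ℕ.+ d ℕ.+ r) ℕ.+ suc (i ℕ.+ d ℕ.+ r)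
          double = ℕ-solver.solve-∀
          cost : i ℕ.* 2 ℕ.+ (1 ℕ.+ r ℕ.* 2) ℕ.≤ suc q
          cost = ℕ.+-cancelʳ-≤ (d ℕ.* 2) _ (suc q) (ℕ.≤-trans
            (ℕ.≤-reflexive (trans (double i d r) (cong (λ k → k ℕ.+ suc k) eq)))
            (ℕ.+-monoʳ-≤ (suc q) (ℕ.≰⇒> long)))

    next-above : ∀ A i → next (π (A + + i)) ≡ π (A + + suc i)
    next-above A i = trans (π-next (A + + i)) (cong π (lemma A (+ i)))
      where
      lemma : ∀ A i → A + i + 1ℤ ≡ A + (1ℤ + i)
      lemma = solve-∀

    full-turn : ∀ A → π (A + + n) ≡ π A
    full-turn A = π-cong (A + + n) A 1ℤ (cong (_+_ A) (sym (ℤ.*-identityˡ (+ n))))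

    module AlternatingReach = Reach Alternating Alternating-splits
    module BlockReach = Reach Blocks Blocks-splits

    alternating-edge : ∀ u → AlternatingReach.Reach 2 u (next u)
    alternating-edge u (alternating-from s _) =
      two-letter-walk s (consecutive u) , two-letter-walk s (swap (consecutive u))

    alternating-bidirected-edge : ∀ u → Bidirected u → AlternatingReach.Reach 1 u (next u)
    alternating-bidirected-edge u (a , b) (alternating-from true _)  = (a ∷ []) , (b ∷ [])
    alternating-bidirected-edge u (a , b) (alternating-from false _) = (b ∷ []) , (a ∷ [])

    block-edge : ∀ u → BlockReach.Reach 1 u (next u)
    block-edge u (block s []) =
      two-letter-walk s (consecutive u) , two-letter-walk s (swap (consecutive u))

    module _ (dec : ∀ u → Dec (Bidirected u)) where

      -- An alternating word crosses a bidirected arc in one letter and any arc in two, so length n - 2 is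
      -- enough for all pairs if at most one arc is one-way, and length n - 1 if some arc is bidirected:
      -- the two ways between two vertices then cost at most 2n - 1 letters in total.  In the latter case
      -- a letter is wasted at a one-way arc above A.  If all arcs are one-way, each block of two opposite
      -- letters crosses any arc, but wastes a letter in the cover.
      universal-word : ∀ A → ∃[ w ] Climb A w (A + + q) × (∀ u v → Walk w u v)
      universal-word A with bidirected-or-climb dec q A
      ... | inj₁ bs = alternating true q , climb-alternating true q A , λ u v →
        proj₁ (reach-along-segment A
          (λ i l → subst (Reach 1 _) (next-above A i) (alternating-bidirected-edge _ (bs i l)))
          -- The closing edge may be one-way and then takes two letters, which fits because n ≥ 4.
          (Reach-mono 2≤q (subst (Reach 2 _) (trans (next-above A (suc q)) (full-turn A)) (alternating-edge _)))
          u v (alternating-from true q))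
        where open AlternatingReach
      ... | inj₂ (s , climb) with Fin.any? dec
      ...   | yes (x , b) = alternating s (suc q) , climb , λ u v →
        proj₁ (reach-with-shortcut B
          (λ i → subst (Reach 2 _) (next-above B i) (alternating-edge _))
          (subst₂ (Reach 1) x≡ next-x≡ (alternating-bidirected-edge x b))
          u v (alternating-from s (suc q)))
        where
        open AlternatingReach
        -- Starting just above `x` makes the bidirected edge the one that closes the path.
        B = + toℕ x + 1ℤ
        x≡ : x ≡ π (B + + suc q)
        x≡ = trans (sym (π-toℕ x)) (trans (sym (full-turn (+ toℕ x))) (cong π (sym (raise (+ toℕ x) (suc q)))))
        next-x≡ : next x ≡ π B
        next-x≡ = trans (cong next (sym (π-toℕ x))) (π-next (+ toℕ x))
      ...   | no none with climb-blocks (λ u b → none (u , b)) q A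
      ...     | w , k , climb′ = w , climb′ , λ u v →
        proj₁ (reach-along-segment A
          (λ i _ → subst (Reach 1 _) (next-above A i) (block-edge _))
          (Reach-mono (ℕ.≤-trans (s≤s z≤n) 2≤q)
            (subst (Reach 1 _) (trans (next-above A (suc q)) (full-turn A)) (block-edge _)))
          u v k)
        where open BlockReach

    -- The range of a lifted polymorphism.

    module _ {k} {f : Vec (Fin n) k → Fin n} (hom : IsPolymorphism digraph k f) (lift : Lift (power digraph k) f) where

      private
        F = proj₁ lift
        over = proj₁ (proj₂ lift)

        near-Move : ∀ s {xs ys : Vec (Fin n) k} → Pointwise (Move s) xs ys → dist (F xs) (F ys) ℕ.≤ 1
        near-Move true  as = proj₂ (proj₂ lift) as
        near-Move false {xs} {ys} as = dist-flip (F ys) (F xs) (proj₂ (proj₂ lift) (Pointwise.sym (λ a → a) as))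

        hom-Move : ∀ s {xs ys : Vec (Fin n) k} → Pointwise (Move s) xs ys → Move s (f xs) (f ys)
        hom-Move true  as = hom as
        hom-Move false as = hom (Pointwise.sym (λ a → a) as)

        first-move : ∀ {s w j} {xs ys : Vec (Fin n) j} → Pointwise (Walk (s ∷ w)) xs ys →
                     Σ[ zs ∈ Vec (Fin n) j ] Pointwise (Move s) xs zs × Pointwise (Walk w) zs ys
        first-move []                 = [] , [] , []
        first-move ((m ∷ walk) ∷ ws) with first-move ws
        ... | zs , ms , ws′ = _ ∷ zs , m ∷ ms , walk ∷ ws′

      -- A letter raises F by at most 1, so the ceiling `A` can be broken only by a step from `A` to
      -- `A + 1`. The image of such a step under f is the move that `stay` excludes.
      climb-sound : ∀ {A w B} {xs ys : Vec (Fin n) k} → Climb A w B → Pointwise (Walk w) xs ys → F xs ℤ.≤ A → F ys ℤ.≤ B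
      climb-sound {xs = xs} {ys} [] ws F≤ = subst (λ zs → F zs ℤ.≤ _) (no-move ws) F≤
        where
        no-move : ∀ {j} {xs ys : Vec (Fin n) j} → Pointwise (Walk []) xs ys → xs ≡ ys
        no-move []        = refl
        no-move ([] ∷ ws) = cong (_ ∷_) (no-move ws)
      climb-sound {A} {s ∷ w} {xs = xs} (up climb) ws F≤ with first-move ws
      ... | zs , ms , ws′ = climb-sound climb ws′
        (ℤ.≤-trans (≤-of-dist (F xs) (F zs) (near-Move s ms)) (ℤ.+-monoˡ-≤ 1ℤ F≤))
      climb-sound {A} {s ∷ w} {xs = xs} (stay ¬m climb) ws F≤ with first-move ws
      ... | zs , ms , ws′ = climb-sound climb ws′ (low (F zs ℤ.≤? A))
        where
        F-zs≤ : F zs ℤ.≤ F xs + 1ℤ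
        F-zs≤ = ≤-of-dist (F xs) (F zs) (near-Move s ms)
        low : Dec (F zs ℤ.≤ A) → F zs ℤ.≤ A
        low (yes F-zs≤A) = F-zs≤A
        low (no F-zs≰A)  = ⊥-elim (¬m (subst₂ (Move s)
          (trans (sym (over xs)) (cong π F-xs≡)) (trans (sym (over zs)) (cong π F-zs≡)) (hom-Move s ms)))
          where
          A+1≤ : A + 1ℤ ℤ.≤ F zs
          A+1≤ = subst (ℤ._≤ F zs) (ℤ.+-comm 1ℤ A) (ℤ.i<j⇒suc[i]≤j (ℤ.≰⇒> F-zs≰A))
          F-zs≡ : F zs ≡ A + 1ℤ
          F-zs≡ = ℤ.≤-antisym (ℤ.≤-trans F-zs≤ (ℤ.+-monoˡ-≤ 1ℤ F≤)) A+1≤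
          F-xs≡ : F xs ≡ A
          F-xs≡ = ℤ.≤-antisym F≤ (subst₂ ℤ._≤_ (cancel A) (cancel (F xs)) (ℤ.+-monoˡ-≤ -1ℤ (ℤ.≤-trans A+1≤ F-zs≤)))
            where
            cancel : ∀ a → a + 1ℤ + -1ℤ ≡ a
            cancel = solve-∀

      lift-range : (∀ u → Dec (Bidirected u)) → ∀ xs ys → F ys ℤ.≤ F xs + + q
      lift-range dec xs ys with universal-word dec (F xs)
      ... | w , climb , universal = climb-sound climb (everywhere xs ys) ℤ.≤-refl
        where
        everywhere : ∀ {j} (xs ys : Vec (Fin n) j) → Pointwise (Walk w) xs ys
        everywhere []       []       = []
        everywhere (x ∷ xs) (y ∷ ys) = universal x y ∷ everywhere xs ys

      -- Surjectivity provides some `ys` over the vertex just below `F xs`. As F varies by at most n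
      -- - 2, `F ys` is within n - 1 of `F xs - 1` and hence equal to it. Descending `suc q` times
      -- leaves the permitted range.
      lift-not-surjective : ¬ Surjective _≡_ _≡_ f
      lift-not-surjective surj = ¬¬-decidable Bidirected contradiction
        where
        contradiction : ¬ (∀ u → Dec (Bidirected u))
        contradiction dec = absurd (descend (suc q))
          where
          range = lift-range dec
          one-lower : ∀ xs → ∃[ ys ] F ys ≡ F xs - 1ℤ
          one-lower xs = ys , π-injective (F ys) (F xs - 1ℤ) (trans (over ys) (proj₂ (surj _) refl))
            (s≤s (ℕ.≤-trans (dist-triangle (F ys) (F xs) (F xs - 1ℤ)
              (dist-of-≤ (F ys) (F xs) (range xs ys) (range ys xs))
              (ℕ.≤-reflexive (dist-shift (F xs) -1ℤ))) (ℕ.≤-reflexive (ℕ.+-comm q 1))))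
            where ys = proj₁ (surj (π (F xs - 1ℤ)))
          start = proj₁ (surj zero)
          descend : ∀ m → ∃[ xs ] F xs ≡ F start - + m
          descend zero    = start , sym (ℤ.+-identityʳ (F start))
          descend (suc m) =
            let xs , e  = descend m
                ys , e′ = one-lower xs
            in ys , trans e′ (trans (cong (_- 1ℤ) e) (lemma (F start) (+ m)))
            where
            lemma : ∀ a m → a - m - 1ℤ ≡ a - (1ℤ + m)
            lemma = solve-∀
          absurd : ∃[ xs ] F xs ≡ F start - + suc q → ⊥
          absurd (xs , e) = ℤ.<-irrefl refl (ℤ.<-≤-trans below (range xs start))
            where
            lemma : ∀ a q → a - (1ℤ + q) + q ≡ -1ℤ + a
            lemma = solve-∀
            below : F xs + + q ℤ.< F start
            below = subst (ℤ._< F start) (sym (trans (cong (_+ + q) e) (lemma (F start) (+ q)))) (ℤ.i≤pred[j]⇒i<j ℤ.≤-refl)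

theorem1p1 : ∀ {e : Level} (n : ℕ) → n ≥ 4 → (𝔾 : Cycle n e) → Słupecki (Cycle.digraph 𝔾)
theorem1p1 (suc (suc q)) (s≤s (s≤s 2≤q)) 𝔾 k _ f hom surj =
  Sum.[ (λ lift → ⊥-elim (lift-not-surjective 𝔾 hom lift surj)) , unary ]′ (lift-or-depends 𝔾 k f hom)
  where
  open Cycle 𝔾
  open LiftRange q 2≤q
  unary : ∃[ i ] DependsOn 𝔾 i f → EssentiallyUnary digraph k f
  unary (i , g , _ , eq) = i , g , g-hom , eq
    where
    -- On the diagonal f agrees with `g`, so `g` inherits the preservation of arcs.
    diagonal : ∀ u → f (replicate k u) ≡ g u
    diagonal u = trans (eq (replicate k u)) (cong g (lookup-replicate i u))
    constant : ∀ {u v} → u ⟶ v → ∀ j → Pointwise _⟶_ (replicate j u) (replicate j v)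
    constant a zero    = []
    constant a (suc j) = a ∷ constant a j
    g-hom : IsHomomorphism digraph digraph g
    g-hom {u} {v} a = subst₂ _⟶_ (diagonal u) (diagonal v) (hom (constant a k))
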